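{- Suppose $[0,1]_*=([0,1],\min,\max,*,\rightarrowtail,0,1)$ is a BL-algebra. Then every $*$-ball of $[0,1]_*$ is a $*$-open set.
   Context: A BL-algebra is an algebra $\mathcal{L}=(L,\wedge,\vee,*,\rightarrowtail,0,1)$ of type $(2,2,2,2,0,0)$ such that: (BL1) $(L,\wedge,\vee,0,1)$ is a bounded lattice with greatest element $1$ and smallest element $0$; (BL2) $(L,*,1)$ is an Abelian monoid; (BL3) $c\le a\rightarrowtail b$ iff $c*a\le b$ for all $a,b,c\in L$; (BL4) $a\wedge b=a*(a\rightarrowtail b)$ for all $a,b\in L$; (BL5) $(a\rightarrowtail b)\vee(b\rightarrowtail a)=1$ for all $a,b\in L$. Here $L=[0,1]$ is the real unit interval with its usual order. An element $a\in L$ is strongly less than $1$, written $a\ll 1$, if for every $b\in L$, $a\vee b=1$ implies $b=1$ (on $[0,1]$ this just means $a<1$). Define $a\leftrightarrow b=(a\rightarrowtail b)*(b\rightarrowtail a)$ for $a,b\in L$. For $a,r\in L$ with $r\ll 1$, the $*$-ball around $a$ of radius $r$ is $B_r(a)=\{b\in L: a\leftrightarrow b>r\}$. A subset $G\subseteq L$ is $*$-open if for every $a\in G$ there exists $r\in L$ with $r\ll 1$ and $B_r(a)\subseteq G$. -}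

module Defs where

open import Algebra.Core using (Op₂)
open import Algebra.Structures using (IsCommutativeMonoid)
open import Data.Product using (_×_; _,_; ∃-syntax)
open import Data.Rational using (ℚ; 0ℚ; 1ℚ; -_) renaming (_<_ to _<ℚ_; _≤_ to _≤ℚ_; _⊓_ to _⊓ℚ_; _⊔_ to _⊔ℚ_; _+_ to _+ℚ_)
import Data.Rational.Properties as ℚ
open import Data.Sum using (_⊎_; inj₁; inj₂)
open import Function using (_⇔_; _on_)
open import Level using (0ℓ; suc) renaming (_⊔_ to _⊔ˡ_)
open import Relation.Binary.Core using (Rel)
open import Relation.Binary.Definitions using (tri<; tri≈; tri>)
open import Relation.Binary.Lattice.Structures using (IsBoundedLattice)
open import Relation.Binary.PropositionalEquality using (refl; subst; sym)
open import Relation.Unary using (Pred; _∈_; _∉_; _⊆_; _∪_; _∩_)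
import Relation.Binary.Construct.NonStrictToStrict as Strict

------------------------------------------------------------------------
-- BL-algebras

record IsBLAlgebra {c ℓ₁ ℓ₂} {L : Set c} (_≈_ : Rel L ℓ₁) (_≤_ : Rel L ℓ₂)
                   (_∧_ _∨_ _*_ _↣_ : Op₂ L) (𝟎 𝟏 : L)
                   : Set (c ⊔ˡ ℓ₁ ⊔ˡ ℓ₂) where
  field
    isBoundedLattice    : IsBoundedLattice _≈_ _≤_ _∨_ _∧_ 𝟏 𝟎
    isCommutativeMonoid : IsCommutativeMonoid _≈_ _*_ 𝟏
    -- This also makes _↣_ respect _≈_, so no congruence field is needed.
    residuated          : ∀ a b c → (c ≤ (a ↣ b)) ⇔ ((c * a) ≤ b)
    divisible           : ∀ a b → (a ∧ b) ≈ (a * (a ↣ b))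
    prelinear           : ∀ a b → ((a ↣ b) ∨ (b ↣ a)) ≈ 𝟏

record BLAlgebra c ℓ₁ ℓ₂ : Set (suc (c ⊔ˡ ℓ₁ ⊔ˡ ℓ₂)) where
  infix  4 _≈_ _≤_ _>_ _≪𝟏
  infixr 5 _↣_ _↔_
  infixr 6 _∨_
  infixr 7 _∧_ _*_
  field
    Carrier     : Set c
    _≈_         : Rel Carrier ℓ₁
    _≤_         : Rel Carrier ℓ₂
    _∧_ _∨_     : Op₂ Carrier
    _*_ _↣_     : Op₂ Carrier
    𝟎 𝟏         : Carrier
    isBLAlgebra : IsBLAlgebra _≈_ _≤_ _∧_ _∨_ _*_ _↣_ 𝟎 𝟏

  open IsBLAlgebra isBLAlgebra public

  -- The strict part of the lattice order, y ≤ x and y ≠ x.  On [0,1] this is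
  -- the usual strict order of the reals, classically; no rational separating
  -- the two elements is demanded.
  _>_ : Rel Carrier (ℓ₁ ⊔ˡ ℓ₂)
  x > y = Strict._<_ _≈_ _≤_ y x

  _≪𝟏 : Pred Carrier (c ⊔ˡ ℓ₁)
  a ≪𝟏 = ∀ b → a ∨ b ≈ 𝟏 → b ≈ 𝟏

  _↔_ : Op₂ Carrier
  a ↔ b = (a ↣ b) * (b ↣ a)

  Ball : Carrier → Carrier → Pred Carrier (ℓ₁ ⊔ˡ ℓ₂)
  Ball a r b = a ↔ b > r

  -- If ¬ (𝟎 ≈ 𝟏), an open predicate automatically respects _≈_, because
  -- every ball with a radius ≪𝟏 contains all elements equal to its centre.
  IsOpen : ∀ {ℓ} → Pred Carrier ℓ → Set (c ⊔ˡ ℓ₁ ⊔ˡ ℓ₂ ⊔ˡ ℓ)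
  IsOpen G = ∀ a → a ∈ G → ∃[ r ] (r ≪𝟏 × Ball a r ⊆ G)

------------------------------------------------------------------------
-- Real numbers, as (two-sided, located) Dedekind cuts of ℚ

record ℝ : Set₁ where
  field
    lower upper : Pred ℚ 0ℓ
    lower-inhabited : ∃[ p ] p ∈ lower
    upper-inhabited : ∃[ p ] p ∈ upper
    lower-closed    : ∀ {p q} → p <ℚ q → q ∈ lower → p ∈ lower
    upper-closed    : ∀ {p q} → p <ℚ q → p ∈ upper → q ∈ upper
    lower-rounded   : ∀ {p} → p ∈ lower → ∃[ q ] (p <ℚ q × q ∈ lower)
    upper-rounded   : ∀ {q} → q ∈ upper → ∃[ p ] (p <ℚ q × p ∈ upper)
    disjoint        : ∀ {p} → p ∈ lower → p ∉ upper
    located         : ∀ {p q} → p <ℚ q → p ∈ lower ⊎ q ∈ upper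

open ℝ

infix 4 _≤ℝ_ _≈ℝ_

_≤ℝ_ : Rel ℝ 0ℓ
x ≤ℝ y = lower x ⊆ lower y

_≈ℝ_ : Rel ℝ 0ℓ
x ≈ℝ y = x ≤ℝ y × y ≤ℝ x

private
  p-1<p : ∀ p → p +ℚ (- 1ℚ) <ℚ p
  p-1<p p = subst (p +ℚ (- 1ℚ) <ℚ_) (ℚ.+-identityʳ p)
                  (ℚ.+-monoʳ-< p (ℚ.negative⁻¹ (- 1ℚ)))

  p<p+1 : ∀ p → p <ℚ p +ℚ 1ℚ
  p<p+1 p = subst (_<ℚ p +ℚ 1ℚ) (ℚ.+-identityʳ p)
                  (ℚ.+-monoʳ-< p (ℚ.positive⁻¹ 1ℚ))

  ⊓-glb-< : ∀ {p q r} → p <ℚ q → p <ℚ r → p <ℚ q ⊓ℚ r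
  ⊓-glb-< {p} {q} {r} p<q p<r with ℚ.⊓-sel q r
  ... | inj₁ eq = subst (p <ℚ_) (sym eq) p<q
  ... | inj₂ eq = subst (p <ℚ_) (sym eq) p<r

  ⊔-lub-< : ∀ {p q r} → q <ℚ p → r <ℚ p → q ⊔ℚ r <ℚ p
  ⊔-lub-< {p} {q} {r} q<p r<p with ℚ.⊔-sel q r
  ... | inj₁ eq = subst (_<ℚ p) (sym eq) q<p
  ... | inj₂ eq = subst (_<ℚ p) (sym eq) r<p

  lower-≤ : ∀ x {p q} → p ≤ℚ q → q ∈ lower x → p ∈ lower x
  lower-≤ x {p} {q} p≤q q∈ with lower-rounded x q∈
  ... | s , q<s , s∈ = lower-closed x (ℚ.≤-<-trans p≤q q<s) s∈

  upper-≤ : ∀ x {p q} → p ≤ℚ q → p ∈ upper x → q ∈ upper x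
  upper-≤ x p≤q p∈ with upper-rounded x p∈
  ... | s , s<p , s∈ = upper-closed x (ℚ.<-≤-trans s<p p≤q) s∈

fromℚ : ℚ → ℝ
fromℚ r = record
  { lower           = _<ℚ r
  ; upper           = r <ℚ_
  ; lower-inhabited = r +ℚ (- 1ℚ) , p-1<p r
  ; upper-inhabited = r +ℚ 1ℚ , p<p+1 r
  ; lower-closed    = ℚ.<-trans
  ; upper-closed    = λ p<q r<p → ℚ.<-trans r<p p<q
  ; lower-rounded   = ℚ.<-dense
  ; upper-rounded   = λ r<q → let s , r<s , s<q = ℚ.<-dense r<q in s , s<q , r<s
  ; disjoint        = ℚ.<-asym
  ; located         = loc
  }
  where
  loc : ∀ {p q} → p <ℚ q → p <ℚ r ⊎ r <ℚ q
  loc {p} p<q with ℚ.<-cmp p r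
  ... | tri< p<r _ _  = inj₁ p<r
  ... | tri≈ _ refl _ = inj₂ p<q
  ... | tri> _ _ r<p  = inj₂ (ℚ.<-trans r<p p<q)

minℝ : Op₂ ℝ
minℝ x y = record
  { lower           = lower x ∩ lower y
  ; upper           = upper x ∪ upper y
  ; lower-inhabited =
      let p , p∈ = lower-inhabited x
          q , q∈ = lower-inhabited y
      in p ⊓ℚ q , lower-≤ x (ℚ.p⊓q≤p p q) p∈ , lower-≤ y (ℚ.p⊓q≤q p q) q∈
  ; upper-inhabited = let p , p∈ = upper-inhabited x in p , inj₁ p∈
  ; lower-closed    = λ p<q (a , b) → lower-closed x p<q a , lower-closed y p<q b
  ; upper-closed    = λ { p<q (inj₁ a) → inj₁ (upper-closed x p<q a)
                        ; p<q (inj₂ b) → inj₂ (upper-closed y p<q b) }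
  ; lower-rounded   = λ (a , b) →
      let p , l<p , p∈ = lower-rounded x a
          q , l<q , q∈ = lower-rounded y b
      in p ⊓ℚ q , ⊓-glb-< l<p l<q
         , lower-≤ x (ℚ.p⊓q≤p p q) p∈ , lower-≤ y (ℚ.p⊓q≤q p q) q∈
  ; upper-rounded   = λ { (inj₁ a) → let p , p<q , p∈ = upper-rounded x a in p , p<q , inj₁ p∈
                        ; (inj₂ b) → let p , p<q , p∈ = upper-rounded y b in p , p<q , inj₂ p∈ }
  ; disjoint        = λ { (a , _) (inj₁ u) → disjoint x a u
                        ; (_ , b) (inj₂ u) → disjoint y b u }
  ; located         = loc
  }
  where
  loc : ∀ {p q} → p <ℚ q → p ∈ lower x ∩ lower y ⊎ q ∈ upper x ∪ upper y
  loc p<q with located x p<q | located y p<q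
  ... | inj₁ a | inj₁ b = inj₁ (a , b)
  ... | inj₂ u | _      = inj₂ (inj₁ u)
  ... | inj₁ _ | inj₂ u = inj₂ (inj₂ u)

maxℝ : Op₂ ℝ
maxℝ x y = record
  { lower           = lower x ∪ lower y
  ; upper           = upper x ∩ upper y
  ; lower-inhabited = let p , p∈ = lower-inhabited x in p , inj₁ p∈
  ; upper-inhabited =
      let p , p∈ = upper-inhabited x
          q , q∈ = upper-inhabited y
      in p ⊔ℚ q , upper-≤ x (ℚ.p≤p⊔q p q) p∈ , upper-≤ y (ℚ.p≤q⊔p p q) q∈
  ; lower-closed    = λ { p<q (inj₁ a) → inj₁ (lower-closed x p<q a)
                        ; p<q (inj₂ b) → inj₂ (lower-closed y p<q b) }
  ; upper-closed    = λ p<q (a , b) → upper-closed x p<q a , upper-closed y p<q b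
  ; lower-rounded   = λ { (inj₁ a) → let p , p<q , p∈ = lower-rounded x a in p , p<q , inj₁ p∈
                        ; (inj₂ b) → let p , p<q , p∈ = lower-rounded y b in p , p<q , inj₂ p∈ }
  ; upper-rounded   = λ (a , b) →
      let p , p<u , p∈ = upper-rounded x a
          q , q<u , q∈ = upper-rounded y b
      in p ⊔ℚ q , ⊔-lub-< p<u q<u
         , upper-≤ x (ℚ.p≤p⊔q p q) p∈ , upper-≤ y (ℚ.p≤q⊔p p q) q∈
  ; disjoint        = λ { (inj₁ a) (u , _) → disjoint x a u
                        ; (inj₂ b) (_ , u) → disjoint y b u }
  ; located         = loc
  }
  where
  loc : ∀ {p q} → p <ℚ q → p ∈ lower x ∪ lower y ⊎ q ∈ upper x ∩ upper y
  loc p<q with located x p<q | located y p<q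
  ... | inj₁ a | _      = inj₁ (inj₁ a)
  ... | inj₂ _ | inj₁ b = inj₁ (inj₂ b)
  ... | inj₂ u | inj₂ v = inj₂ (u , v)

------------------------------------------------------------------------
-- The unit interval

record 𝕀 : Set₁ where
  constructor mk𝕀
  field
    value : ℝ
    0≤    : fromℚ 0ℚ ≤ℝ value
    ≤1    : value ≤ℝ fromℚ 1ℚ

open 𝕀

infix 4 _≤ᴵ_ _≈ᴵ_

_≤ᴵ_ _≈ᴵ_ : Rel 𝕀 0ℓ
_≤ᴵ_ = _≤ℝ_ on value
_≈ᴵ_ = _≈ℝ_ on value

0ᴵ 1ᴵ : 𝕀
0ᴵ = mk𝕀 (fromℚ 0ℚ) (λ p<0 → p<0) (λ p<0 → ℚ.<-trans p<0 (ℚ.positive⁻¹ 1ℚ))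
1ᴵ = mk𝕀 (fromℚ 1ℚ) (λ p<0 → ℚ.<-trans p<0 (ℚ.positive⁻¹ 1ℚ)) (λ p<1 → p<1)

min max : Op₂ 𝕀
min x y = mk𝕀 (minℝ (value x) (value y))
              (λ l → 0≤ x l , 0≤ y l)
              (λ (l , _) → ≤1 x l)
max x y = mk𝕀 (maxℝ (value x) (value y))
              (λ l → inj₁ (0≤ x l))
              (λ { (inj₁ l) → ≤1 x l ; (inj₂ l) → ≤1 y l })

module _ {_*_ _↣_ : Op₂ 𝕀} where

  [0,1]⟨_⟩ : IsBLAlgebra _≈ᴵ_ _≤ᴵ_ min max _*_ _↣_ 0ᴵ 1ᴵ → BLAlgebra (suc 0ℓ) 0ℓ 0ℓ
  [0,1]⟨ isBL ⟩ = record { isBLAlgebra = isBL }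

{-# OPTIONS --safe #-}
-- With t = a ↔ x > r, the radius t ↣ r works for a ball around x: divisibility
-- gives r = t * (t ↣ r) ≤ t * u for u ≥ t ↣ r, residuation turns t * u ≤ r into
-- u ≤ t ↣ r, and t * (x ↔ y) ≤ a ↔ y.  The radius is ≪ 1 because it is not 1.
module Submission where

open import Defs
open import Algebra.Core using (Op₂)
open import Algebra.Structures using (module IsCommutativeMonoid)
open import Data.Empty using (⊥-elim)
open import Data.Product using (_,_)
import Data.Rational.Properties as ℚ
open import Data.Sum using (inj₁; inj₂)
open import Function.Bundles using (module Equivalence)
open import Relation.Binary.Lattice.Structures using (module IsBoundedLattice)
open import Relation.Binary.Definitions using (tri<; tri≈; tri>)
open import Relation.Binary.PropositionalEquality using (refl)
open import Relation.Nullary using (¬_)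

module BLAlgebraProperties {c ℓ₁ ℓ₂} (B : BLAlgebra c ℓ₁ ℓ₂) where
  open BLAlgebra B
  open IsBoundedLattice isBoundedLattice
    using (antisym; trans; reflexive; ∧-greatest; module Eq)
    renaming (refl to ≤-refl)
  open IsCommutativeMonoid isCommutativeMonoid
    using (assoc; comm; ∙-congˡ; ∙-congʳ; identityˡ)

  residuate : ∀ {x y z} → z * x ≤ y → z ≤ x ↣ y
  residuate {x} {y} {z} = Equivalence.from (residuated x y z)

  unresiduate : ∀ {x y z} → z ≤ x ↣ y → z * x ≤ y
  unresiduate {x} {y} {z} = Equivalence.to (residuated x y z)

  -- By residuation `_* z` is a left adjoint, hence monotone.
  *-monoˡ : ∀ {x y} z → x ≤ y → x * z ≤ y * z
  *-monoˡ z x≤y = unresiduate (trans x≤y (residuate ≤-refl))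

  *-monoʳ : ∀ {x y} z → x ≤ y → z * x ≤ z * y
  *-monoʳ z x≤y =
    trans (reflexive (comm _ _)) (trans (*-monoˡ z x≤y) (reflexive (comm _ _)))

  *-mono : ∀ {w x y z} → w ≤ x → y ≤ z → w * y ≤ x * z
  *-mono w≤x y≤z = trans (*-monoˡ _ w≤x) (*-monoʳ _ y≤z)

  ↣-trans : ∀ x y z → (x ↣ y) * (y ↣ z) ≤ x ↣ z
  ↣-trans x y z = residuate
    -- Bring `x` next to `x ↣ y`, so that modus ponens fires twice: from `x` to `y`, then from `y`
    -- to `z`.
    (trans (reflexive (Eq.trans (∙-congʳ (comm _ _)) (assoc _ _ _)))
    (trans (*-monoʳ _ (unresiduate ≤-refl)) (unresiduate ≤-refl)))

  -- Serves `↔-trans`: it separates forward from backward residua. The last two factors swap because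
  -- the backward ones compose as `z ↣ y`, then `y ↣ x`.
  *-interchange : ∀ w x y z → (w * x) * (y * z) ≈ (w * y) * (z * x)
  *-interchange w x y z =
    Eq.trans (assoc _ _ _)
    (Eq.trans (∙-congˡ (Eq.trans (comm _ _) (assoc _ _ _)))
              (Eq.sym (assoc _ _ _)))

  ↔-trans : ∀ x y z → (x ↔ y) * (y ↔ z) ≤ x ↔ z
  ↔-trans x y z =
    trans (reflexive (*-interchange _ _ _ _)) (*-mono (↣-trans x y z) (↣-trans z y x))

  x>y⇒x↣y≉𝟏 : ∀ {x y} → x > y → ¬ (x ↣ y ≈ 𝟏)
  x>y⇒x↣y≉𝟏 (y≤x , y≉x) eq = y≉x (antisym y≤x
    (trans (reflexive (Eq.sym (identityˡ _))) (unresiduate (reflexive (Eq.sym eq)))))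

  x≥y⇒y≤x*[x↣y] : ∀ {x y} → y ≤ x → y ≤ x * (x ↣ y)
  x≥y⇒y≤x*[x↣y] {x} {y} y≤x =
    trans (∧-greatest y≤x ≤-refl) (reflexive (divisible x y))

  -- The hypothesis is where linearity of the order enters: in a product of two nontrivial
  -- BL-algebras, (0,1) and (1,0) join to 1 although neither is 1.
  Ball-isOpen : (∀ {x} → ¬ (x ≈ 𝟏) → x ≪𝟏) → ∀ a r → IsOpen (Ball a r)
  Ball-isOpen ≉𝟏⇒≪𝟏 a r x t>r@(r≤t , _) =
    (a ↔ x) ↣ r , ≉𝟏⇒≪𝟏 (x>y⇒x↣y≉𝟏 t>r) , λ {y} (s≤u , s≉u) →
      trans (x≥y⇒y≤x*[x↣y] r≤t) (trans (*-monoʳ _ s≤u) (↔-trans a x y)) ,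
      -- Strictness: equality would give u * t ≤ r, hence u ≤ s, so s and u would coincide.
      λ r≈a↔y → s≉u (antisym s≤u (residuate
        (trans (reflexive (comm _ _))
        (trans (↔-trans a x y) (reflexive (Eq.sym r≈a↔y))))))

-- Locatedness of the cut of `y` stands in for deciding whether `y` is below 1.
max≈1⇒≈1 : ∀ x y → ¬ (x ≈ᴵ 1ᴵ) → max x y ≈ᴵ 1ᴵ → y ≈ᴵ 1ᴵ
max≈1⇒≈1 x y x≉1 (_ , 1≤max) = 𝕀.≤1 y , 1≤y
  where
  open ℝ

  1≤y : 1ᴵ ≤ᴵ y
  1≤y p<1 with ℚ.<-dense p<1
  ... | q , p<q , q<1 with located (𝕀.value y) p<q
  ...   | inj₁ p∈ = p∈
  -- Here y < q < 1, so `x` alone must bring the maximum up to 1, against `x≉1`.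
  ...   | inj₂ q∈ = ⊥-elim (x≉1 (𝕀.≤1 x , 1≤x))
    where
    1≤x : 1ᴵ ≤ᴵ x
    -- At `s` the maximum may still be witnessed by `y`; at `q` only `x` can witness it, which
    -- covers every s ≤ q.
    1≤x {s} s<1 with 1≤max s<1 | 1≤max q<1
    ... | inj₁ s∈x | _        = s∈x
    ... | inj₂ _   | inj₂ q∈y = ⊥-elim (disjoint (𝕀.value y) q∈y q∈)
    ... | inj₂ s∈y | inj₁ q∈x with ℚ.<-cmp s q
    ...   | tri< s<q _ _  = lower-closed (𝕀.value x) s<q q∈x
    ...   | tri≈ _ refl _ = q∈x
    ...   | tri> _ _ q<s  =
      ⊥-elim (disjoint (𝕀.value y) (lower-closed (𝕀.value y) q<s s∈y) q∈)

theorem4p1 : (_*_ _↣_ : Op₂ 𝕀)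
    (isBL : IsBLAlgebra _≈ᴵ_ _≤ᴵ_ min max _*_ _↣_ 0ᴵ 1ᴵ) →
    (a r : 𝕀) → BLAlgebra._≪𝟏 [0,1]⟨ isBL ⟩ r →
    BLAlgebra.IsOpen [0,1]⟨ isBL ⟩ (BLAlgebra.Ball [0,1]⟨ isBL ⟩ a r)
theorem4p1 _*_ _↣_ isBL a r _ =
  BLAlgebraProperties.Ball-isOpen [0,1]⟨ isBL ⟩ (λ {x} x≉1 y → max≈1⇒≈1 x y x≉1) a r
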